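{- For all binary relations $R$ and $S$ on IMP states and every IMP command $c'$, $\vDash \langle R\rangle\ \mathbf{skip},\ c'\ \langle S\rangle$ holds if and only if for every state $t$, $\langle \lambda s'.\,R(t,s')\rangle\ c'\ \langle \lambda t'.\,S(t,t')\rangle$ holds.
   Context: IMP commands: $c ::= x := e \mid c;c \mid \mathbf{if}\ b\ \mathbf{then}\ c\ \mathbf{else}\ c \mid \mathbf{while}\ b\ \mathbf{do}\ c \mid \mathbf{skip}$ over integer arithmetic expressions $e$ and boolean expressions $b$. States map variables to integers; $(c,s)\Rightarrow t$ is the standard big-step semantics of IMP (in particular $(\mathbf{skip},s)\Rightarrow t$ iff $t=s$). Relations are binary relations on states. Under-approximate relational validity: $\vDash \langle R\rangle\ c,\ c'\ \langle S\rangle$ iff $\forall t\,t'.\ S(t,t') \implies \exists s\,s'.\ R(s,s')\land (c,s)\Rightarrow t\land (c',s')\Rightarrow t'$. Under-approximate Hoare validity for predicates $P,Q$ on states: $\langle P\rangle\ c\ \langle Q\rangle$ iff $\forall t.\ Q(t)\implies\exists s.\ P(s)\land (c,s)\Rightarrow t$. -}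

module Defs where

open import Data.Nat using (ℕ)
open import Data.Integer using (ℤ; _+_; _-_; _*_; _≤_)
open import Data.Bool using (Bool; true; false; not; _∧_; if_then_else_)
open import Data.Product using (Σ; _×_; ∃; ∃₂)
open import Relation.Binary.PropositionalEquality using (_≡_)
open import Relation.Nullary.Decidable using (⌊_⌋)
import Data.Integer.Properties as ℤP
open import Data.Nat.Properties using (_≟_)

Var : Set
Var = ℕ

State : Set
State = Var → ℤ

data AExp : Set where
  N    : ℤ → AExp
  V    : Var → AExp
  Plus : AExp → AExp → AExp
  Minus : AExp → AExp → AExp
  Times : AExp → AExp → AExp

aval : AExp → State → ℤ
aval (N n) s = n
aval (V x) s = s x
aval (Plus a b) s = aval a s + aval b s
aval (Minus a b) s = aval a s - aval b s
aval (Times a b) s = aval a s * aval b s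

data BExp : Set where
  Bc   : Bool → BExp
  Not  : BExp → BExp
  And  : BExp → BExp → BExp
  Less : AExp → AExp → BExp

bval : BExp → State → Bool
bval (Bc v) s = v
bval (Not b) s = not (bval b s)
bval (And b c) s = bval b s ∧ bval c s
bval (Less a b) s = ⌊ aval a s ℤP.≤? aval b s ⌋

data Com : Set where
  SKIP   : Com
  _::=_  : Var → AExp → Com
  _⨾_   : Com → Com → Com
  IF_THEN_ELSE_ : BExp → Com → Com → Com
  WHILE_DO_ : BExp → Com → Com

_[_↦_] : State → Var → ℤ → State
(s [ x ↦ v ]) y = if ⌊ y ≟ x ⌋ then v else s y

data ⟨_,_⟩⇒_ : Com → State → State → Set where
  Skip    : ∀ {s} → ⟨ SKIP , s ⟩⇒ s
  Assign  : ∀ {x a s} → ⟨ x ::= a , s ⟩⇒ (s [ x ↦ aval a s ])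
  Seq     : ∀ {c₁ c₂ s₁ s₂ s₃} → ⟨ c₁ , s₁ ⟩⇒ s₂ → ⟨ c₂ , s₂ ⟩⇒ s₃ → ⟨ c₁ ⨾ c₂ , s₁ ⟩⇒ s₃
  IfTrue  : ∀ {b c₁ c₂ s t} → bval b s ≡ true → ⟨ c₁ , s ⟩⇒ t → ⟨ IF b THEN c₁ ELSE c₂ , s ⟩⇒ t
  IfFalse : ∀ {b c₁ c₂ s t} → bval b s ≡ false → ⟨ c₂ , s ⟩⇒ t → ⟨ IF b THEN c₁ ELSE c₂ , s ⟩⇒ t
  WhileFalse : ∀ {b c s} → bval b s ≡ false → ⟨ WHILE b DO c , s ⟩⇒ s
  WhileTrue  : ∀ {b c s₁ s₂ s₃} → bval b s₁ ≡ true → ⟨ c , s₁ ⟩⇒ s₂ → ⟨ WHILE b DO c , s₂ ⟩⇒ s₃ → ⟨ WHILE b DO c , s₁ ⟩⇒ s₃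

Rel : Set₁
Rel = State → State → Set

Pred : Set₁
Pred = State → Set

-- Under-approximate relational validity  ⊨ ⟨R⟩ c , c' ⟨S⟩
⊨⟨_⟩_,_⟨_⟩ : Rel → Com → Com → Rel → Set
⊨⟨ R ⟩ c , c' ⟨ S ⟩ =
  ∀ t t' → S t t' → Σ State λ s → Σ State λ s' → R s s' × ⟨ c , s ⟩⇒ t × ⟨ c' , s' ⟩⇒ t'

-- Under-approximate Hoare validity  ⟨P⟩ c ⟨Q⟩
⊨ₕ⟨_⟩_⟨_⟩ : Pred → Com → Pred → Set
⊨ₕ⟨ P ⟩ c ⟨ Q ⟩ = ∀ t → Q t → Σ State λ s → P s × ⟨ c , s ⟩⇒ t

module Submission where

open import Defs
open import Data.Product using (_×_; _,_)
open import Relation.Binary.PropositionalEquality using (_≡_; refl)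

skip-inversion : ∀ {s t} → ⟨ SKIP , s ⟩⇒ t → s ≡ t
skip-inversion Skip = refl

skip-left⇒pointwise-hoare : (R S : Rel) (c' : Com) →
  ⊨⟨ R ⟩ SKIP , c' ⟨ S ⟩ → ∀ t → ⊨ₕ⟨ R t ⟩ c' ⟨ S t ⟩
skip-left⇒pointwise-hoare R S c' valid t t' st
  with valid t t' st
... | s , s' , r , skip , run with skip-inversion skip
...   | refl = s' , r , run

pointwise-hoare⇒skip-left : (R S : Rel) (c' : Com) →
  (∀ t → ⊨ₕ⟨ R t ⟩ c' ⟨ S t ⟩) → ⊨⟨ R ⟩ SKIP , c' ⟨ S ⟩
pointwise-hoare⇒skip-left R S c' valid t t' st =
  let s' , r , run = valid t t' st in t , s' , r , Skip , run

lemma2 : (R S : Rel) (c' : Com) →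
    (⊨⟨ R ⟩ SKIP , c' ⟨ S ⟩ → ∀ t → ⊨ₕ⟨ (λ s' → R t s') ⟩ c' ⟨ (λ t' → S t t') ⟩)
    × ((∀ t → ⊨ₕ⟨ (λ s' → R t s') ⟩ c' ⟨ (λ t' → S t t') ⟩) → ⊨⟨ R ⟩ SKIP , c' ⟨ S ⟩)
lemma2 R S c' = skip-left⇒pointwise-hoare R S c' , pointwise-hoare⇒skip-left R S c'
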